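{- Let $p \geq 5$ be a prime and let $a_1,a_2,a_3 \in \mathbb{F}_p$ with $s := 3+a_1+a_2+a_3 \neq 0$ in $\mathbb{F}_p$. Let $S \subseteq \mathbb{F}_p^3$ be the set of solutions $(x_1,x_2,x_3)$ of \[ x_1^2+x_2^2+x_3^2+a_1x_2x_3+a_2x_1x_3+a_3x_1x_2 = s\,x_1x_2x_3, \] and for $i \in \{1,2,3\}$ (indices taken modulo $3$) let $m_i : S \to S$ be the map replacing $x_i$ by $-x_i + s x_{i-1}x_{i+1} - a_{i+1}x_{i-1} - a_{i-1}x_{i+1}$ and leaving the other two coordinates unchanged. Consider the orbits of the group generated by $m_1,m_2,m_3$ acting on $S$. \begin{enumerate} \item If $a_i^2 \neq 4$ for all $i=1,2,3$, then every orbit other than the orbit $\{(0,0,0)\}$ has size divisible by $p$. \item If there is an index $i$ with $a_i^2 = 4$ and $2a_{i-1} = a_{i+1}a_i$ (indices modulo $3$), then every orbit other than $\{(0,0,0)\}$ has size divisible by $p$. \end{enumerate}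
   Context: Each $m_i$ is an involution of $S$ (it exchanges the two roots of the defining equation viewed as a quadratic in $x_i$). The point $(0,0,0)$ always lies in $S$ and is fixed by all moves. -}

module Defs where

open import Algebra.Bundles using (CommutativeRing)
open import Axiom.UniquenessOfIdentityProofs using (module Decidable⇒UIP)
open import Data.Fin.Base using (Fin; toℕ)
open import Data.Fin.Patterns using (0F; 1F; 2F)
open import Data.Fin.Properties using (toℕ-injective; toℕ-fromℕ<; toℕ<n; _≟_)
open import Data.List.Base using (List; length)
open import Data.List.Membership.Propositional using (_∈_)
open import Data.List.Relation.Unary.Unique.Propositional using (Unique)
open import Data.Nat.Base as ℕ using (ℕ; NonZero)
open import Data.Nat.DivMod using (_%_; _mod_; m%n<n; m%n%n≡m%n; n%n≡0; m<n⇒m%n≡m; %-distribˡ-+; %-distribˡ-*)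
import Data.Nat.Properties as ℕₚ
open import Data.Product.Base using (Σ; _×_; _,_; proj₁; ∃-syntax)
open import Data.Vec.Base using (Vec; []; _∷_; lookup; _[_]≔_)
open import Function.Bundles using (_↔_; _⇔_; Inverse; mk↔ₛ′)
open import Function.Construct.Composition using (_↔-∘_)
open import Function.Construct.Identity using (↔-id)
open import Function.Construct.Symmetry using (↔-sym)
open import Level using (0ℓ)
open import Relation.Binary.PropositionalEquality
open import Relation.Unary using (Pred)

import Algebra.Properties.Ring as RingProperties
import Algebra.Solver.Ring.NaturalCoefficients.Default as SemiringSolver

𝔽 : ℕ → Set
𝔽 = Fin

module _ (p : ℕ) .{{_ : NonZero p}} where

  private
    infixl 6 _⊕_
    infixl 7 _⊗_

    _⊕_ _⊗_ : 𝔽 p → 𝔽 p → 𝔽 p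
    x ⊕ y = (toℕ x ℕ.+ toℕ y) mod p
    x ⊗ y = (toℕ x ℕ.* toℕ y) mod p

    ⊖_ : 𝔽 p → 𝔽 p
    ⊖ x = (p ℕ.∸ toℕ x) mod p

    toℕ-mod : ∀ n → toℕ (n mod p) ≡ n % p
    toℕ-mod n = toℕ-fromℕ< (m%n<n n p)

    mod-cong : ∀ {m n} → m % p ≡ n % p → m mod p ≡ n mod p
    mod-cong {m} {n} eq =
      toℕ-injective (trans (toℕ-mod m) (trans eq (sym (toℕ-mod n))))

    mod-toℕ : ∀ x → toℕ x mod p ≡ x
    mod-toℕ x =
      toℕ-injective (trans (toℕ-mod (toℕ x)) (m<n⇒m%n≡m (toℕ<n x)))

    mod-+ : ∀ m n → (m mod p) ⊕ (n mod p) ≡ (m ℕ.+ n) mod p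
    mod-+ m n = mod-cong (trans
      (cong₂ (λ i j → (i ℕ.+ j) % p) (toℕ-mod m) (toℕ-mod n))
      (sym (%-distribˡ-+ m n p)))

    mod-* : ∀ m n → (m mod p) ⊗ (n mod p) ≡ (m ℕ.* n) mod p
    mod-* m n = mod-cong (trans
      (cong₂ (λ i j → (i ℕ.* j) % p) (toℕ-mod m) (toℕ-mod n))
      (sym (%-distribˡ-* m n p)))

    mod-+ˡ : ∀ m y → (m mod p) ⊕ y ≡ (m ℕ.+ toℕ y) mod p
    mod-+ˡ m y = trans (cong ((m mod p) ⊕_) (sym (mod-toℕ y))) (mod-+ m (toℕ y))

    mod-+ʳ : ∀ x n → x ⊕ (n mod p) ≡ (toℕ x ℕ.+ n) mod p
    mod-+ʳ x n = trans (cong (_⊕ (n mod p)) (sym (mod-toℕ x))) (mod-+ (toℕ x) n)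

    mod-*ˡ : ∀ m y → (m mod p) ⊗ y ≡ (m ℕ.* toℕ y) mod p
    mod-*ˡ m y = trans (cong ((m mod p) ⊗_) (sym (mod-toℕ y))) (mod-* m (toℕ y))

    mod-*ʳ : ∀ x n → x ⊗ (n mod p) ≡ (toℕ x ℕ.* n) mod p
    mod-*ʳ x n = trans (cong (_⊗ (n mod p)) (sym (mod-toℕ x))) (mod-* (toℕ x) n)

    modEq : ∀ {m n} → m ≡ n → m mod p ≡ n mod p
    modEq = cong (_mod p)

    ⊕-comm : ∀ x y → x ⊕ y ≡ y ⊕ x
    ⊕-comm x y = modEq (ℕₚ.+-comm (toℕ x) (toℕ y))

    ⊗-comm : ∀ x y → x ⊗ y ≡ y ⊗ x
    ⊗-comm x y = modEq (ℕₚ.*-comm (toℕ x) (toℕ y))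

    ⊕-assoc : ∀ x y z → (x ⊕ y) ⊕ z ≡ x ⊕ (y ⊕ z)
    ⊕-assoc x y z = trans (mod-+ˡ _ z) (trans
      (modEq (ℕₚ.+-assoc (toℕ x) (toℕ y) (toℕ z))) (sym (mod-+ʳ x _)))

    ⊗-assoc : ∀ x y z → (x ⊗ y) ⊗ z ≡ x ⊗ (y ⊗ z)
    ⊗-assoc x y z = trans (mod-*ˡ _ z) (trans
      (modEq (ℕₚ.*-assoc (toℕ x) (toℕ y) (toℕ z))) (sym (mod-*ʳ x _)))

    ⊕-identityˡ : ∀ x → (0 mod p) ⊕ x ≡ x
    ⊕-identityˡ x = trans (mod-+ˡ 0 x) (mod-toℕ x)

    ⊗-identityˡ : ∀ x → (1 mod p) ⊗ x ≡ x
    ⊗-identityˡ x =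
      trans (mod-*ˡ 1 x) (trans (modEq (ℕₚ.*-identityˡ (toℕ x))) (mod-toℕ x))

    ⊖-inverseʳ : ∀ x → x ⊕ (⊖ x) ≡ 0 mod p
    ⊖-inverseʳ x = trans (mod-+ʳ x _) (trans
      (modEq (ℕₚ.m+[n∸m]≡n (ℕₚ.<⇒≤ (toℕ<n x))))
      (mod-cong (trans (n%n≡0 p) (sym (m<n⇒m%n≡m (ℕ.>-nonZero⁻¹ p))))))

    distribˡ : ∀ x y z → x ⊗ (y ⊕ z) ≡ x ⊗ y ⊕ x ⊗ z
    distribˡ x y z = trans (mod-*ʳ x _) (trans
      (modEq (ℕₚ.*-distribˡ-+ (toℕ x) (toℕ y) (toℕ z))) (sym (mod-+ _ _)))

    distribʳ : ∀ x y z → (y ⊕ z) ⊗ x ≡ y ⊗ x ⊕ z ⊗ x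
    distribʳ x y z = trans (⊗-comm (y ⊕ z) x)
      (trans (distribˡ x y z) (cong₂ _⊕_ (⊗-comm x y) (⊗-comm x z)))

  𝔽-commutativeRing : CommutativeRing 0ℓ 0ℓ
  𝔽-commutativeRing = record
    { Carrier = 𝔽 p
    ; _≈_ = _≡_
    ; _+_ = _⊕_
    ; _*_ = _⊗_
    ; -_ = ⊖_
    ; 0# = 0 mod p
    ; 1# = 1 mod p
    ; isCommutativeRing = record
      { isRing = record
        { +-isAbelianGroup = record
          { isGroup = record
            { isMonoid = record
              { isSemigroup = record
                { isMagma = isMagma _⊕_
                ; assoc = ⊕-assoc
                }
              ; identity = ⊕-identityˡ
                , λ x → trans (⊕-comm x _) (⊕-identityˡ x)
              }
            ; inverse = (λ x → trans (⊕-comm (⊖ x) x) (⊖-inverseʳ x))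
              , ⊖-inverseʳ
            ; ⁻¹-cong = cong ⊖_
            }
          ; comm = ⊕-comm
          }
        ; *-cong = cong₂ _⊗_
        ; *-assoc = ⊗-assoc
        ; *-identity = ⊗-identityˡ
          , λ x → trans (⊗-comm x _) (⊗-identityˡ x)
        ; distrib = distribˡ , distribʳ
        }
      ; *-comm = ⊗-comm
      }
    }
    where open import Relation.Binary.PropositionalEquality.Algebra using (isMagma)

-- The subgroup of Sym(A) generated by the family g.
data ⟨_⟩ {A I : Set} (g : I → A ↔ A) : Pred (A ↔ A) 0ℓ where
  generator : ∀ i → ⟨ g ⟩ (g i)
  identity  : ⟨ g ⟩ (↔-id A)
  compose   : ∀ {h k} → ⟨ g ⟩ h → ⟨ g ⟩ k → ⟨ g ⟩ (h ↔-∘ k)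
  inverse   : ∀ {h} → ⟨ g ⟩ h → ⟨ g ⟩ (↔-sym h)

Orbit : {A I : Set} → (I → A ↔ A) → A → Pred A 0ℓ
Orbit g x y = ∃[ h ] ⟨ g ⟩ h × Inverse.to h x ≡ y

-- The list xs enumerates P without repetitions.
HasSize : {A : Set} → Pred A 0ℓ → ℕ → Set
HasSize {A} P n =
  ∃[ xs ] Unique xs × length xs ≡ n × (∀ (y : A) → y ∈ xs ⇔ P y)

-- The coordinates 1, 2, 3 are the indices 0F, 1F, 2F.
next prev : Fin 3 → Fin 3
next 0F = 1F
next 1F = 2F
next 2F = 0F
prev 0F = 2F
prev 1F = 0F
prev 2F = 1F

module Surface (p : ℕ) .{{_ : NonZero p}} (a : Vec (𝔽 p) 3) where

  open CommutativeRing (𝔽-commutativeRing p)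
    using (_+_; _*_; -_; _-_; 0#; ring; commutativeSemiring; +-identityʳ; -‿inverseʳ)

  s : 𝔽 p
  s = 3 mod p + lookup a 0F + lookup a 1F + lookup a 2F

  private
    Eqn : (a₁ a₂ a₃ x₁ x₂ x₃ : 𝔽 p) → Set
    Eqn a₁ a₂ a₃ x₁ x₂ x₃ =
      x₁ * x₁ + x₂ * x₂ + x₃ * x₃
        + a₁ * x₂ * x₃ + a₂ * x₁ * x₃ + a₃ * x₁ * x₂
      ≡ s * x₁ * x₂ * x₃

  Equation : Vec (𝔽 p) 3 → Set
  Equation x = Eqn (lookup a 0F) (lookup a 1F) (lookup a 2F)
                   (lookup x 0F) (lookup x 1F) (lookup x 2F)

  S : Set
  S = Σ (Vec (𝔽 p) 3) Equation

  moved : Fin 3 → Vec (𝔽 p) 3 → 𝔽 p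
  moved i x = - lookup x i + s * lookup x (prev i) * lookup x (next i)
    - lookup a (next i) * lookup x (prev i)
    - lookup a (prev i) * lookup x (next i)

  moveVec : Fin 3 → Vec (𝔽 p) 3 → Vec (𝔽 p) 3
  moveVec i x = x [ i ]≔ moved i x

  private
    open SemiringSolver commutativeSemiring
    open RingProperties ring using (+-cancelˡ)

    origin-Eqn : ∀ a₁ a₂ a₃ → Eqn a₁ a₂ a₃ 0# 0# 0#
    origin-Eqn a₁ a₂ a₃ = solve 4 (λ a₁ a₂ a₃ s →
        O :* O :+ O :* O :+ O :* O :+ a₁ :* O :* O :+ a₂ :* O :* O :+ a₃ :* O :* O
        := s :* O :* O :* O)
      refl a₁ a₂ a₃ s
      where
      O : ∀ {n} → Polynomial n
      O = con 0

    -- u and its image sum to minus the linear coefficient of the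
    -- equation, viewed as a monic quadratic in one coordinate.
    vieta : ∀ u t b c → u + (- u + t - b - c) + b + c ≡ t
    vieta u t b c = trans
      (solve 7 (λ u t b c u′ b′ c′ →
          u :+ (u′ :+ t :+ b′ :+ c′) :+ b :+ c
          := t :+ ((u :+ u′) :+ (b :+ b′) :+ (c :+ c′)))
        refl u t b c (- u) (- b) (- c))
      (trans (cong (t +_) (cong₂ _+_ (cong₂ _+_ (-‿inverseʳ u) (-‿inverseʳ b)) (-‿inverseʳ c)))
      (trans (cong (t +_) (trans (cong (_+ 0#) (+-identityʳ 0#)) (+-identityʳ 0#)))
             (+-identityʳ t)))

    swapRoot : ∀ a₁ a₂ a₃ u u′ y z →
      u + u′ + a₂ * z + a₃ * y ≡ s * z * y →
      Eqn a₁ a₂ a₃ u y z → Eqn a₁ a₂ a₃ u′ y z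
    swapRoot a₁ a₂ a₃ u u′ y z sum eq = begin
      u′ * u′ + y * y + z * z + a₁ * y * z + a₂ * u′ * z + a₃ * u′ * y
        ≡⟨ solve 7 (λ a₁ a₂ a₃ u u′ y z →
             u′ :* u′ :+ y :* y :+ z :* z :+ a₁ :* y :* z :+ a₂ :* u′ :* z :+ a₃ :* u′ :* y
             := (y :* y :+ z :* z :+ a₁ :* y :* z) :+ u′ :* (u′ :+ a₂ :* z :+ a₃ :* y))
             refl a₁ a₂ a₃ u u′ y z ⟩
      C + u′ * (u′ + a₂ * z + a₃ * y)
        ≡⟨ cong (_+ u′ * (u′ + a₂ * z + a₃ * y)) product ⟩
      u * u′ + u′ * (u′ + a₂ * z + a₃ * y)
        ≡⟨ solve 6 (λ a₂ a₃ u u′ y z →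
             u :* u′ :+ u′ :* (u′ :+ a₂ :* z :+ a₃ :* y)
             := u′ :* (u :+ u′ :+ a₂ :* z :+ a₃ :* y))
             refl a₂ a₃ u u′ y z ⟩
      u′ * (u + u′ + a₂ * z + a₃ * y)
        ≡⟨ cong (u′ *_) sum ⟩
      u′ * (s * z * y)
        ≡⟨ solve 4 (λ s u′ y z → u′ :* (s :* z :* y) := s :* u′ :* y :* z)
             refl s u′ y z ⟩
      s * u′ * y * z ∎
      where
      open ≡-Reasoning
      C = y * y + z * z + a₁ * y * z
      q = u * (u + a₂ * z + a₃ * y)
      product : C ≡ u * u′
      product = +-cancelˡ q C (u * u′) (begin
        q + C
          ≡⟨ solve 6 (λ a₁ a₂ a₃ u y z →
               u :* (u :+ a₂ :* z :+ a₃ :* y) :+ (y :* y :+ z :* z :+ a₁ :* y :* z)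
               := u :* u :+ y :* y :+ z :* z :+ a₁ :* y :* z :+ a₂ :* u :* z :+ a₃ :* u :* y)
               refl a₁ a₂ a₃ u y z ⟩
        u * u + y * y + z * z + a₁ * y * z + a₂ * u * z + a₃ * u * y
          ≡⟨ eq ⟩
        s * u * y * z
          ≡⟨ solve 4 (λ s u y z → s :* u :* y :* z := u :* (s :* z :* y)) refl s u y z ⟩
        u * (s * z * y)
          ≡⟨ cong (u *_) (sym sum) ⟩
        u * (u + u′ + a₂ * z + a₃ * y)
          ≡⟨ solve 6 (λ a₂ a₃ u u′ y z →
               u :* (u :+ u′ :+ a₂ :* z :+ a₃ :* y)
               := u :* (u :+ a₂ :* z :+ a₃ :* y) :+ u :* u′)
               refl a₂ a₃ u u′ y z ⟩
        q + u * u′ ∎)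

    rotate : ∀ a₁ a₂ a₃ x y z → Eqn a₁ a₂ a₃ x y z → Eqn a₂ a₃ a₁ y z x
    rotate a₁ a₂ a₃ x y z eq = trans
      (solve 6 (λ a₁ a₂ a₃ x y z →
          y :* y :+ z :* z :+ x :* x :+ a₂ :* z :* x :+ a₃ :* y :* x :+ a₁ :* y :* z
          := x :* x :+ y :* y :+ z :* z :+ a₁ :* y :* z :+ a₂ :* x :* z :+ a₃ :* x :* y)
        refl a₁ a₂ a₃ x y z)
      (trans eq (solve 4 (λ s x y z → s :* x :* y :* z := s :* y :* z :* x)
        refl s x y z))

    negate-twice : ∀ u t b c → - (- u + t - b - c) + t - b - c ≡ u
    negate-twice u t b c = +-cancelˡ (v + b + c) _ _ (trans
      (solve 4 (λ v w b c → (v :+ b :+ c) :+ w := v :+ w :+ b :+ c)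
        refl v (- v + t - b - c) b c)
      (trans (vieta v t b c) (trans (sym (vieta u t b c))
        (solve 4 (λ u v b c → u :+ v :+ b :+ c := (v :+ b :+ c) :+ u)
          refl u v b c))))
      where v = - u + t - b - c

  moveVec-involutive : ∀ i x → moveVec i (moveVec i x) ≡ x
  moveVec-involutive 0F (x ∷ y ∷ z ∷ []) = cong (_∷ y ∷ z ∷ [])
    (negate-twice x (s * z * y) (lookup a 1F * z) (lookup a 2F * y))
  moveVec-involutive 1F (x ∷ y ∷ z ∷ []) = cong (λ w → x ∷ w ∷ z ∷ [])
    (negate-twice y (s * x * z) (lookup a 2F * x) (lookup a 0F * z))
  moveVec-involutive 2F (x ∷ y ∷ z ∷ []) = cong (λ w → x ∷ y ∷ w ∷ [])
    (negate-twice z (s * y * x) (lookup a 0F * y) (lookup a 1F * x))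

  moveVec-preserves : ∀ i x → Equation x → Equation (moveVec i x)
  moveVec-preserves 0F v@(x ∷ y ∷ z ∷ []) eq =
    swapRoot a₁ a₂ a₃ x (moved 0F v) y z
      (vieta x (s * z * y) (a₂ * z) (a₃ * y)) eq
    where a₁ = lookup a 0F
          a₂ = lookup a 1F
          a₃ = lookup a 2F
  moveVec-preserves 1F v@(x ∷ y ∷ z ∷ []) eq =
    rotate a₃ a₁ a₂ z x y′ (rotate a₂ a₃ a₁ y′ z x
      (swapRoot a₂ a₃ a₁ y y′ z x
        (vieta y (s * x * z) (a₃ * x) (a₁ * z))
        (rotate a₁ a₂ a₃ x y z eq)))
    where a₁ = lookup a 0F
          a₂ = lookup a 1F
          a₃ = lookup a 2F
          y′ = moved 1F v
  moveVec-preserves 2F v@(x ∷ y ∷ z ∷ []) eq =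
    rotate a₃ a₁ a₂ z′ x y
      (swapRoot a₃ a₁ a₂ z z′ x y
        (vieta z (s * y * x) (a₁ * y) (a₂ * x))
        (rotate a₂ a₃ a₁ y z x (rotate a₁ a₂ a₃ x y z eq)))
    where a₁ = lookup a 0F
          a₂ = lookup a 1F
          a₃ = lookup a 2F
          z′ = moved 2F v

  origin : S
  origin = 0# ∷ 0# ∷ 0# ∷ []
    , origin-Eqn (lookup a 0F) (lookup a 1F) (lookup a 2F)

  S-≡ : ∀ {x y : S} → proj₁ x ≡ proj₁ y → x ≡ y
  S-≡ {x , e} {.x , e′} refl = cong (x ,_) (Decidable⇒UIP.≡-irrelevant _≟_ e e′)

  move : Fin 3 → S → S
  move i (x , e) = moveVec i x , moveVec-preserves i x e

  move-involutive : ∀ i x → move i (move i x) ≡ x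
  move-involutive i (x , e) = S-≡ (moveVec-involutive i x)

  m : Fin 3 → S ↔ S
  m i = mk↔ₛ′ (move i) (move i) (move-involutive i) (move-involutive i)

{-# OPTIONS --safe #-}

-- Every point v ≠ 0 of S gets three weights W₁ v, W₂ v, W₃ v in 𝔽_p such that
-- W₁ v + W₂ v + W₃ v = 2s and Wᵢ v + Wᵢ (mᵢ v) = 2s.  Since mᵢ permutes an
-- orbit O, summing the latter over O gives 2 Σ Wᵢ = 2s|O| for each i, and
-- summing the former gives Σ W₁ + Σ W₂ + Σ W₃ = 2s|O|.  Hence
-- 4s|O| = 6s|O|, so |O| = 0 in 𝔽_p because 2s ≠ 0.
--
-- If no coordinate vanishes, Wᵢ = 2xᵢ/(xⱼxₖ) + aⱼ/xⱼ + aₖ/xₖ: the two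
-- identities are the equation of S divided by x₁x₂x₃ and Vieta's formula
-- divided by xⱼxₖ.  A point v ≠ 0 has at most one vanishing coordinate xᵢ;
-- there Wⱼ and Wₖ are replaced by affine functions of 1/xⱼ and 1/xₖ, whose
-- coefficients solve a linear system with determinant 4 − aᵢ².  The hypotheses
-- of the theorem make all three systems solvable.
module Submission where

open import Defs
open import Algebra.Bundles using (CommutativeMonoid; CommutativeRing)
import Algebra.Properties.CommutativeMonoid.Sum as Sum
import Algebra.Properties.Group as GroupProperties
import Algebra.Properties.Ring as RingProperties
import Algebra.Properties.Semiring.Mult as Mult
import Algebra.Solver.Ring.NaturalCoefficients.Default as SemiringSolver
open import Data.Fin.Base using (Fin; zero; suc; toℕ; combine)
open import Data.Fin.Patterns using (0F; 1F; 2F)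
import Data.Fin.Permutation as Perm
open import Data.Fin.Properties
  using (_≟_; any?; injective⇒≤; inj⇒≟; toℕ<n; toℕ-fromℕ<; toℕ-injective; combine-injective)
open import Data.List.Base using (List; []; _∷_; length) renaming (lookup to lookupᴸ)
import Data.List.Membership.DecPropositional as DecMembership
open import Data.List.Membership.Propositional using (_∈_; _∉_)
open import Data.List.Membership.Propositional.Properties using (∈-lookup)
open import Data.List.Relation.Unary.All as All using (All; []; _∷_)
open import Data.List.Relation.Unary.All.Properties using (¬Any⇒All¬)
open import Data.List.Relation.Unary.AllPairs using ([]; _∷_)
open import Data.List.Relation.Unary.Any using (here; there; index)
open import Data.List.Relation.Unary.Any.Properties using (lookup-index)
open import Data.List.Relation.Unary.Unique.Propositional using (Unique)
open import Data.Nat.Base as ℕ using (ℕ; zero; suc; NonZero; _≤_)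
open import Data.Nat.Coprimality using (prime⇒coprime; coprime-Bézout)
open import Data.Nat.Divisibility using (_∣_; m%n≡0⇒n∣m)
open import Data.Nat.DivMod using (_%_; _mod_; m%n<n; m<n⇒m%n≡m; n%n≡0; %-distribˡ-+; %-distribˡ-*)
open import Data.Nat.GCD using (module Bézout)
open import Data.Nat.Primality using (Prime)
import Data.Nat.Properties as ℕₚ
open import Data.Product.Base using (_×_; _,_; proj₁; proj₂; ∃-syntax)
open import Data.Vec.Base using (Vec; []; _∷_; lookup)
open import Function.Base using (_∘_)
open import Function.Bundles using (_↔_; _↣_; _⇔_; mk⇔; mk↣; Equivalence; Inverse; Injection)
open import Function.Construct.Composition using (_↔-∘_)
open import Level using (Level; 0ℓ; _⊔_)
import Relation.Binary.Reasoning.Setoid as SetoidReasoning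
open import Relation.Nullary.Decidable using (Dec; yes; no; ¬?; decidable-stable)
open import Relation.Nullary.Negation using (contradiction)
open import Relation.Nullary.Negation.Core using (¬_)
open import Relation.Unary using (Pred; ｛_｝; _≐_)

-- Weight identities over a commutative ring

module WeightIdentities {r ℓ : Level} (R : CommutativeRing r ℓ) where

  open CommutativeRing R hiding (zero)
  open SemiringSolver commutativeSemiring hiding (_:-_; :-_)
  open RingProperties ring using (+-cancelˡ; -0#≈0#)
  open SetoidReasoning setoid

  -- For a = aᵢ, b = aⱼ, c = aₖ, these are the coefficients of the weights
  -- Wⱼ = s + A/xⱼ + B/xₖ and Wₖ = s + C/xⱼ + D/xₖ at points with xᵢ = 0.
  record Correction (a b c : Carrier) : Set (r ⊔ ℓ) where
    field
      A B C D : Carrier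
      B+B≈aA  : B + B ≈ a * A
      C+C≈aD  : C + C ≈ a * D
      A+C+b≈0 : A + C + b ≈ 0#
      B+D+c≈0 : B + D + c ≈ 0#

  four : Carrier
  four = (1# + 1#) + (1# + 1#)

  -- Substituting `B = aA/2` and `C = aD/2` into the last two equations leaves a 2 × 2 linear system
  -- for `A` and `D`. The formulas are Cramer's rule, with `e` the inverse of `four - a * a`.
  correction-generic : ∀ a b c e → (four - a * a) * e ≈ 1# → Correction a b c
  correction-generic a b c e inv = record
    { A = e * (X + X) ; B = a * e * X ; C = a * e * Y ; D = e * (Y + Y)
    ; B+B≈aA = solve 3 (λ a e X → a :* e :* X :+ a :* e :* X := a :* (e :* (X :+ X))) refl a e X
    ; C+C≈aD = solve 3 (λ a e X → a :* e :* X :+ a :* e :* X := a :* (e :* (X :+ X))) refl a e Y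
    -- Exchanging `b` and `c` exchanges the two equations, so `vanish` proves both.
    ; A+C+b≈0 = vanish b (- b) c (- c) (-‿inverseʳ b) (-‿inverseʳ c)
    ; B+D+c≈0 = trans (+-congʳ (+-comm _ _)) (vanish c (- c) b (- b) (-‿inverseʳ c) (-‿inverseʳ b))
    }
    where
    X = a * c + (- b + - b)
    Y = a * b + (- c + - c)
    d = four - a * a
    d+a² : d + a * a ≈ four
    d+a² = trans (+-assoc _ _ _) (trans (+-congˡ (-‿inverseˡ (a * a))) (+-identityʳ four))
    -- `b′` and `c′` stand for the negatives of `b` and `c`, because the solver works in semirings.
    vanish : ∀ b b′ c c′ → b + b′ ≈ 0# → c + c′ ≈ 0# →
      e * ((a * c + (b′ + b′)) + (a * c + (b′ + b′))) + a * e * (a * b + (c′ + c′)) + b ≈ 0#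
    vanish b b′ c c′ bb′ cc′ = begin
      e * ((a * c + (b′ + b′)) + (a * c + (b′ + b′))) + a * e * (a * b + (c′ + c′)) + b
        -- The lone `b` becomes `d * e * b`, so that `e` factors out.
        ≈⟨ +-congˡ (sym (trans (*-congʳ inv) (*-identityˡ b))) ⟩
      e * ((a * c + (b′ + b′)) + (a * c + (b′ + b′))) + a * e * (a * b + (c′ + c′)) + d * e * b
        ≈⟨ solve 7 (λ a b b′ c c′ d e →
             e :* ((a :* c :+ (b′ :+ b′)) :+ (a :* c :+ (b′ :+ b′)))
               :+ a :* e :* (a :* b :+ (c′ :+ c′)) :+ d :* e :* b
             := e :* ((a :+ a) :* (c :+ c′) :+ ((d :+ a :* a) :* b :+ con 4 :* b′)))
             refl a b b′ c c′ d e ⟩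
      e * ((a + a) * (c + c′) + ((d + a * a) * b + (1# + 1# + 1# + 1#) * b′))
        ≈⟨ *-congˡ (+-cong (trans (*-congˡ cc′) (zeroʳ _)) (+-congʳ (*-congʳ d+a²))) ⟩
      e * (0# + (four * b + (1# + 1# + 1# + 1#) * b′))
        ≈⟨ solve 3 (λ b b′ e →
             e :* (con 0 :+ (((con 1 :+ con 1) :+ (con 1 :+ con 1)) :* b :+ con 4 :* b′))
             := e :* con 4 :* (b :+ b′)) refl b b′ e ⟩
      e * (1# + 1# + 1# + 1#) * (b + b′)
        ≈⟨ trans (*-congˡ bb′) (zeroʳ _) ⟩
      0# ∎

  -- When `a * a` is 4 the linear system is singular, and the hypothesis is its compatibility
  -- condition. Setting `C` and `D` to 0 forces `A = - b` and `B = - c`.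
  correction-special : ∀ a b c → c + c ≈ a * b → Correction a b c
  correction-special a b c 2c≈ab = record
    { A = - b ; B = - c ; C = 0# ; D = 0#
    ; B+B≈aA = +-cancelˡ (a * b) _ _ (begin
        a * b + (- c + - c)   ≈⟨ +-congʳ (sym 2c≈ab) ⟩
        c + c + (- c + - c)   ≈⟨ solve 2 (λ c c′ → c :+ c :+ (c′ :+ c′)
                                 := (c :+ c′) :+ (c :+ c′)) refl c (- c) ⟩
        (c + - c) + (c + - c) ≈⟨ +-cong (-‿inverseʳ c) (-‿inverseʳ c) ⟩
        0# + 0#               ≈⟨ +-identityʳ 0# ⟩
        0#                    ≈⟨ sym (zeroʳ a) ⟩
        a * 0#                ≈⟨ *-congˡ (sym (-‿inverseʳ b)) ⟩
        a * (b + - b)         ≈⟨ distribˡ a b (- b) ⟩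
        a * b + a * - b       ∎)
    ; C+C≈aD = trans (+-identityʳ 0#) (sym (zeroʳ a))
    ; A+C+b≈0 = trans (+-congʳ (+-identityʳ _)) (-‿inverseˡ b)
    ; B+D+c≈0 = trans (+-congʳ (+-identityʳ _)) (-‿inverseˡ c)
    }

  -- ȳ and z̄ stand for the inverses of y and z, and similarly below.
  generic-weight : (b c u ȳ z̄ : Carrier) → Carrier
  generic-weight b c u ȳ z̄ = (u + u) * (ȳ * z̄) + (b * ȳ + c * z̄)

  generic-pairing : ∀ s b c u u′ y ȳ z z̄ → y * ȳ ≈ 1# → z * z̄ ≈ 1# →
    u + u′ + b * z + c * y ≈ s * z * y →
    generic-weight b c u ȳ z̄ + generic-weight b c u′ ȳ z̄ ≈ s + s
  generic-pairing s b c u u′ y ȳ z z̄ yȳ zz̄ sum = begin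
    generic-weight b c u ȳ z̄ + generic-weight b c u′ ȳ z̄
      ≈⟨ solve 6 (λ b c u u′ ȳ z̄ →
           (u :+ u) :* (ȳ :* z̄) :+ (b :* ȳ :+ c :* z̄) :+ ((u′ :+ u′) :* (ȳ :* z̄) :+ (b :* ȳ :+ c :* z̄))
           := con 2 :* ((u :+ u′) :* (ȳ :* z̄) :+ b :* ȳ :* con 1 :+ c :* z̄ :* con 1))
           refl b c u u′ ȳ z̄ ⟩
    (1# + 1#) * ((u + u′) * (ȳ * z̄) + b * ȳ * 1# + c * z̄ * 1#)
      -- Factors 1 become `z * z̄` and `y * ȳ`, so that `ȳ * z̄` factors out and leaves the left
      -- side of Vieta's formula.
      ≈⟨ *-congˡ (+-cong (+-congˡ (*-congˡ (sym zz̄))) (*-congˡ (sym yȳ))) ⟩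
    (1# + 1#) * ((u + u′) * (ȳ * z̄) + b * ȳ * (z * z̄) + c * z̄ * (y * ȳ))
      ≈⟨ solve 8 (λ b c u u′ y ȳ z z̄ →
           con 2 :* ((u :+ u′) :* (ȳ :* z̄) :+ b :* ȳ :* (z :* z̄) :+ c :* z̄ :* (y :* ȳ))
           := con 2 :* ((ȳ :* z̄) :* (u :+ u′ :+ b :* z :+ c :* y)))
           refl b c u u′ y ȳ z z̄ ⟩
    (1# + 1#) * ((ȳ * z̄) * (u + u′ + b * z + c * y))
      ≈⟨ *-congˡ (*-congˡ sum) ⟩
    (1# + 1#) * ((ȳ * z̄) * (s * z * y))
      ≈⟨ solve 5 (λ s y ȳ z z̄ → con 2 :* ((ȳ :* z̄) :* (s :* z :* y))
           := con 2 :* (s :* ((y :* ȳ) :* (z :* z̄)))) refl s y ȳ z z̄ ⟩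
    (1# + 1#) * (s * ((y * ȳ) * (z * z̄)))
      ≈⟨ *-congˡ (*-congˡ (*-cong yȳ zz̄)) ⟩
    (1# + 1#) * (s * (1# * 1#))
      ≈⟨ solve 1 (λ s → con 2 :* (s :* (con 1 :* con 1)) := s :+ s) refl s ⟩
    s + s ∎

  generic-total : ∀ s a b c x x̄ y ȳ z z̄ → x * x̄ ≈ 1# → y * ȳ ≈ 1# → z * z̄ ≈ 1# →
    x * x + y * y + z * z + a * y * z + b * x * z + c * x * y ≈ s * x * y * z →
    generic-weight b c x ȳ z̄ + generic-weight c a y z̄ x̄ + generic-weight a b z x̄ ȳ ≈ s + s
  generic-total s a b c x x̄ y ȳ z z̄ xx̄ yȳ zz̄ eq = begin
    generic-weight b c x ȳ z̄ + generic-weight c a y z̄ x̄ + generic-weight a b z x̄ ȳ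
      ≈⟨ solve 9 (λ a b c x x̄ y ȳ z z̄ →
           (x :+ x) :* (ȳ :* z̄) :+ (b :* ȳ :+ c :* z̄) :+ ((y :+ y) :* (z̄ :* x̄) :+ (c :* z̄ :+ a :* x̄))
             :+ ((z :+ z) :* (x̄ :* ȳ) :+ (a :* x̄ :+ b :* ȳ))
           := con 2 :* (x :* ȳ :* z̄ :* con 1 :+ y :* x̄ :* z̄ :* con 1 :+ z :* x̄ :* ȳ :* con 1
                :+ a :* x̄ :* (con 1 :* con 1) :+ b :* ȳ :* (con 1 :* con 1) :+ c :* z̄ :* (con 1 :* con 1)))
           refl a b c x x̄ y ȳ z z̄ ⟩
    (1# + 1#) * (x * ȳ * z̄ * 1# + y * x̄ * z̄ * 1# + z * x̄ * ȳ * 1#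
      + a * x̄ * (1# * 1#) + b * ȳ * (1# * 1#) + c * z̄ * (1# * 1#))
      -- The same device with all three inverses: `x̄ * ȳ * z̄` factors out and leaves the left side
      -- of the equation of the surface.
      ≈⟨ *-congˡ (+-cong (+-cong (+-cong (+-cong (+-cong
           (*-congˡ (sym xx̄)) (*-congˡ (sym yȳ))) (*-congˡ (sym zz̄)))
           (*-congˡ (*-cong (sym yȳ) (sym zz̄)))) (*-congˡ (*-cong (sym xx̄) (sym zz̄))))
           (*-congˡ (*-cong (sym xx̄) (sym yȳ)))) ⟩
    (1# + 1#) * (x * ȳ * z̄ * (x * x̄) + y * x̄ * z̄ * (y * ȳ) + z * x̄ * ȳ * (z * z̄)
      + a * x̄ * ((y * ȳ) * (z * z̄)) + b * ȳ * ((x * x̄) * (z * z̄)) + c * z̄ * ((x * x̄) * (y * ȳ)))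
      ≈⟨ solve 9 (λ a b c x x̄ y ȳ z z̄ →
           con 2 :* (x :* ȳ :* z̄ :* (x :* x̄) :+ y :* x̄ :* z̄ :* (y :* ȳ) :+ z :* x̄ :* ȳ :* (z :* z̄)
             :+ a :* x̄ :* ((y :* ȳ) :* (z :* z̄)) :+ b :* ȳ :* ((x :* x̄) :* (z :* z̄))
             :+ c :* z̄ :* ((x :* x̄) :* (y :* ȳ)))
           := con 2 :* (x̄ :* ȳ :* z̄ :* (x :* x :+ y :* y :+ z :* z
                :+ a :* y :* z :+ b :* x :* z :+ c :* x :* y)))
           refl a b c x x̄ y ȳ z z̄ ⟩
    (1# + 1#) * (x̄ * ȳ * z̄ * (x * x + y * y + z * z + a * y * z + b * x * z + c * x * y))
      ≈⟨ *-congˡ (*-congˡ eq) ⟩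
    (1# + 1#) * (x̄ * ȳ * z̄ * (s * x * y * z))
      ≈⟨ solve 7 (λ s x x̄ y ȳ z z̄ → con 2 :* (x̄ :* ȳ :* z̄ :* (s :* x :* y :* z))
           := con 2 :* (s :* ((x :* x̄) :* (y :* ȳ) :* (z :* z̄)))) refl s x x̄ y ȳ z z̄ ⟩
    (1# + 1#) * (s * ((x * x̄) * (y * ȳ) * (z * z̄)))
      ≈⟨ *-congˡ (*-congˡ (*-cong (*-cong xx̄ yȳ) zz̄)) ⟩
    (1# + 1#) * (s * (1# * 1# * 1#))
      ≈⟨ solve 1 (λ s → con 2 :* (s :* (con 1 :* con 1 :* con 1)) := s :+ s) refl s ⟩
    s + s ∎

  -- The hypothesis on u and z divided by u z².
  inverse-relation : ∀ a u ū z z̄ → u * ū ≈ 1# → z * z̄ ≈ 1# →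
    u * u + z * z + a * u * z ≈ 0# → ū + a * z̄ + u * (z̄ * z̄) ≈ 0#
  inverse-relation a u ū z z̄ uū zz̄ eq = begin
    ū + a * z̄ + u * (z̄ * z̄)
      ≈⟨ solve 4 (λ a u ū z̄ → ū :+ a :* z̄ :+ u :* (z̄ :* z̄)
           := con 1 :* con 1 :* ū :+ con 1 :* con 1 :* (a :* z̄) :+ con 1 :* (u :* (z̄ :* z̄)))
           refl a u ū z̄ ⟩
    1# * 1# * ū + 1# * 1# * (a * z̄) + 1# * (u * (z̄ * z̄))
      ≈⟨ sym (+-cong (+-cong (*-congʳ (*-cong zz̄ zz̄)) (*-congʳ (*-cong uū zz̄))) (*-congʳ uū)) ⟩
    (z * z̄) * (z * z̄) * ū + (u * ū) * (z * z̄) * (a * z̄) + (u * ū) * (u * (z̄ * z̄))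
      ≈⟨ solve 5 (λ a u ū z z̄ →
           (z :* z̄) :* (z :* z̄) :* ū :+ (u :* ū) :* (z :* z̄) :* (a :* z̄) :+ (u :* ū) :* (u :* (z̄ :* z̄))
           := ū :* z̄ :* z̄ :* (u :* u :+ z :* z :+ a :* u :* z)) refl a u ū z z̄ ⟩
    ū * z̄ * z̄ * (u * u + z * z + a * u * z) ≈⟨ *-congˡ eq ⟩
    ū * z̄ * z̄ * 0#                          ≈⟨ zeroʳ _ ⟩
    0# ∎

  -- `u` and `u′` are roots of the same quadratic `t² + a z t + z²`, so their inverses obey a Vieta
  -- relation as well. It is the sum of two instances of `inverse-relation`, in which
  -- `(u + u′) * (z̄ * z̄)` cancels one of the two copies of `a * z̄`.
  inverse-sum : ∀ a u ū u′ ū′ z z̄ → u * ū ≈ 1# → u′ * ū′ ≈ 1# → z * z̄ ≈ 1# →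
    u + u′ + a * z ≈ 0# →
    u * u + z * z + a * u * z ≈ 0# → u′ * u′ + z * z + a * u′ * z ≈ 0# →
    ū + ū′ + a * z̄ ≈ 0#
  inverse-sum a u ū u′ ū′ z z̄ uū u′ū′ zz̄ sum eq eq′ = begin
    ū + ū′ + a * z̄
      ≈⟨ sym (+-identityʳ _) ⟩
    ū + ū′ + a * z̄ + 0#
      ≈⟨ +-congˡ (sym (trans (*-congʳ sum) (zeroˡ (z̄ * z̄)))) ⟩
    ū + ū′ + a * z̄ + (u + u′ + a * z) * (z̄ * z̄)
      ≈⟨ solve 7 (λ a u ū u′ ū′ z z̄ →
           ū :+ ū′ :+ a :* z̄ :+ (u :+ u′ :+ a :* z) :* (z̄ :* z̄)
           := ū :+ ū′ :+ a :* z̄ :+ u :* (z̄ :* z̄) :+ u′ :* (z̄ :* z̄) :+ a :* z̄ :* (z :* z̄))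
           refl a u ū u′ ū′ z z̄ ⟩
    ū + ū′ + a * z̄ + u * (z̄ * z̄) + u′ * (z̄ * z̄) + a * z̄ * (z * z̄)
      ≈⟨ +-congˡ (*-congˡ zz̄) ⟩
    ū + ū′ + a * z̄ + u * (z̄ * z̄) + u′ * (z̄ * z̄) + a * z̄ * 1#
      ≈⟨ solve 6 (λ a u ū u′ ū′ z̄ →
           ū :+ ū′ :+ a :* z̄ :+ u :* (z̄ :* z̄) :+ u′ :* (z̄ :* z̄) :+ a :* z̄ :* con 1
           := (ū :+ a :* z̄ :+ u :* (z̄ :* z̄)) :+ (ū′ :+ a :* z̄ :+ u′ :* (z̄ :* z̄)))
           refl a u ū u′ ū′ z̄ ⟩
    (ū + a * z̄ + u * (z̄ * z̄)) + (ū′ + a * z̄ + u′ * (z̄ * z̄))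
      ≈⟨ +-cong (inverse-relation a u ū z z̄ uū zz̄ eq) (inverse-relation a u′ ū′ z z̄ u′ū′ zz̄ eq′) ⟩
    0# + 0# ≈⟨ +-identityʳ 0# ⟩
    0# ∎

  -- Besides `s + s` the two weights leave `Q * (ū + ū′) + (P + P) * z̄`. The condition on `P` turns
  -- this into `Q` times the relation of `inverse-sum`; hence the first two equations of
  -- `Correction`.
  degenerate-pairing : ∀ s a P Q ū ū′ z̄ → P + P ≈ a * Q → ū + ū′ + a * z̄ ≈ 0# →
    s + P * z̄ + Q * ū + (s + P * z̄ + Q * ū′) ≈ s + s
  degenerate-pairing s a P Q ū ū′ z̄ 2P≈aQ sum = begin
    s + P * z̄ + Q * ū + (s + P * z̄ + Q * ū′)
      ≈⟨ solve 6 (λ s P Q ū ū′ z̄ → s :+ P :* z̄ :+ Q :* ū :+ (s :+ P :* z̄ :+ Q :* ū′)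
           := s :+ s :+ (Q :* (ū :+ ū′) :+ (P :+ P) :* z̄)) refl s P Q ū ū′ z̄ ⟩
    s + s + (Q * (ū + ū′) + (P + P) * z̄)
      ≈⟨ +-congˡ (+-congˡ (*-congʳ 2P≈aQ)) ⟩
    s + s + (Q * (ū + ū′) + a * Q * z̄)
      ≈⟨ +-congˡ (solve 5 (λ a Q ū ū′ z̄ → Q :* (ū :+ ū′) :+ a :* Q :* z̄
           := Q :* (ū :+ ū′ :+ a :* z̄)) refl a Q ū ū′ z̄) ⟩
    s + s + Q * (ū + ū′ + a * z̄)
      ≈⟨ +-congˡ (trans (*-congˡ sum) (zeroʳ Q)) ⟩
    s + s + 0# ≈⟨ +-identityʳ _ ⟩
    s + s ∎

  open Correction

  -- The vanishing coordinate keeps its generic weight, with `u = 0#`. The last two equations of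
  -- `Correction` say that the coefficients of `ȳ` and `z̄` cancel here.
  degenerate-total : ∀ s {a b c} (K : Correction a b c) ȳ z̄ →
    generic-weight b c 0# ȳ z̄ + (s + B K * z̄ + A K * ȳ) + (s + C K * ȳ + D K * z̄) ≈ s + s
  degenerate-total s {b = b} {c} K ȳ z̄ = begin
    generic-weight b c 0# ȳ z̄ + (s + B K * z̄ + A K * ȳ) + (s + C K * ȳ + D K * z̄)
      ≈⟨ solve 9 (λ s A B C D b c ȳ z̄ →
           (con 0 :+ con 0) :* (ȳ :* z̄) :+ (b :* ȳ :+ c :* z̄)
             :+ (s :+ B :* z̄ :+ A :* ȳ) :+ (s :+ C :* ȳ :+ D :* z̄)
           := s :+ s :+ ((A :+ C :+ b) :* ȳ :+ (B :+ D :+ c) :* z̄)) refl s (A K) (B K) (C K) (D K) b c ȳ z̄ ⟩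
    s + s + ((A K + C K + b) * ȳ + (B K + D K + c) * z̄)
      ≈⟨ +-congˡ (+-cong (trans (*-congʳ (A+C+b≈0 K)) (zeroˡ ȳ)) (trans (*-congʳ (B+D+c≈0 K)) (zeroˡ z̄))) ⟩
    s + s + (0# + 0#) ≈⟨ trans (+-congˡ (+-identityʳ 0#)) (+-identityʳ _) ⟩
    s + s ∎

  vieta : ∀ u t b c → u + (- u + t - b - c) + b + c ≈ t
  vieta u t b c = begin
    u + (- u + t - b - c) + b + c
      ≈⟨ solve 7 (λ u t b c u′ b′ c′ → u :+ (u′ :+ t :+ b′ :+ c′) :+ b :+ c
           := t :+ ((u :+ u′) :+ (b :+ b′) :+ (c :+ c′))) refl u t b c (- u) (- b) (- c) ⟩
    t + ((u - u) + (b - b) + (c - c))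
      ≈⟨ +-congˡ (+-cong (+-cong (-‿inverseʳ u) (-‿inverseʳ b)) (-‿inverseʳ c)) ⟩
    t + (0# + 0# + 0#)
      ≈⟨ solve 1 (λ t → t :+ (con 0 :+ con 0 :+ con 0) := t) refl t ⟩
    t ∎

  -- Twice `x + y + z` is `t + t` by the total, and `t + t + t` term by term.
  double-counting : ∀ x y z t → x + x ≈ t → y + y ≈ t → z + z ≈ t → x + y + z ≈ t → t ≈ 0#
  double-counting x y z t x+x≈t y+y≈t z+z≈t total = +-cancelˡ (t + t) t 0# (begin
    t + t + t
      ≈⟨ +-cong (+-cong x+x≈t y+y≈t) z+z≈t ⟨
    (x + x) + (y + y) + (z + z)
      ≈⟨ solve 3 (λ x y z → (x :+ x) :+ (y :+ y) :+ (z :+ z)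
           := (x :+ y :+ z) :+ (x :+ y :+ z) :+ con 0) refl x y z ⟩
    (x + y + z) + (x + y + z) + 0#
      ≈⟨ +-congʳ (+-cong total total) ⟩
    t + t + 0# ∎)

  zero-image : ∀ s b c → - 0# + s * 0# * 0# - b * 0# - c * 0# ≈ 0#
  zero-image s b c = begin
    - 0# + s * 0# * 0# - b * 0# - c * 0#
      ≈⟨ +-cong (+-cong (+-cong -0#≈0# (zeroʳ (s * 0#))) (-‿cong (zeroʳ b))) (-‿cong (zeroʳ c)) ⟩
    0# + 0# - 0# - 0#
      ≈⟨ +-cong (+-cong (+-identityʳ 0#) -0#≈0#) -0#≈0# ⟩
    0# + 0# + 0#
      ≈⟨ trans (+-identityʳ _) (+-identityʳ 0#) ⟩
    0# ∎

open import Relation.Binary.PropositionalEquality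

-- Enumeration of orbits

lookup-injective : ∀ {A : Set} {xs : List A} → Unique xs →
  ∀ {i j} → lookupᴸ xs i ≡ lookupᴸ xs j → i ≡ j
lookup-injective (_ ∷ _)   {zero}  {zero}  _  = refl
lookup-injective (x∉ ∷ _)  {zero}  {suc j} eq = contradiction eq (All.lookup x∉ (∈-lookup j))
lookup-injective (x∉ ∷ _)  {suc i} {zero}  eq = contradiction (sym eq) (All.lookup x∉ (∈-lookup i))
lookup-injective (_ ∷ xs!) {suc i} {suc j} eq = cong suc (lookup-injective xs! eq)

length≤ : ∀ {A : Set} {N} → A ↣ Fin N → {xs : List A} → Unique xs → length xs ≤ N
length≤ e xs! = injective⇒≤ (lookup-injective xs! ∘ Injection.injective e)

module _ {A : Set} {k : ℕ} (g : Fin k → A ↔ A) where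

  open Inverse using (to; from)

  Closed : List A → Set
  Closed xs = ∀ i {y} → y ∈ xs → to (g i) y ∈ xs

  orbit-refl : ∀ {x} → Orbit g x x
  orbit-refl = _ , identity , refl

  orbit-step : ∀ {x y} i → Orbit g x y → Orbit g x (to (g i) y)
  orbit-step i (h , h∈ , refl) = g i ↔-∘ h , compose (generator i) h∈ , refl

  module _ (self-inverse : ∀ i x → from (g i) x ≡ to (g i) x)
           (P : Pred A 0ℓ) (closed : ∀ i {y} → P y → P (to (g i) y)) where

    -- Both directions are proved together, because passing to the inverse permutation exchanges
    -- them. For a generator they coincide by `self-inverse`.
    group-preserves : ∀ {h} → ⟨ g ⟩ h → ∀ {y} → P y → P (to h y) × P (from h y)
    group-preserves (generator i) py =
      closed i py , subst P (sym (self-inverse i _)) (closed i py)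
    group-preserves identity py = py , py
    group-preserves (compose h∈ k∈) py =
      proj₁ (group-preserves h∈ (proj₁ (group-preserves k∈ py))) ,
      proj₂ (group-preserves k∈ (proj₂ (group-preserves h∈ py)))
    group-preserves (inverse h∈) py with group-preserves h∈ py
    ... | p , q = q , p

    orbit-preserves : ∀ {x y} → P x → Orbit g x y → P y
    orbit-preserves px (h , h∈ , refl) = proj₁ (group-preserves h∈ px)

  module _ {N : ℕ} (e : A ↣ Fin N) where

    open DecMembership (inj⇒≟ e) using (_∈?_)

    -- While some generator leads out of `xs`, the new point is added to the list. Repetition-free
    -- lists have at most `N` entries, so `fuel` bounds the number of additions still possible.
    saturate : ∀ x fuel xs → N ≤ fuel ℕ.+ length xs →
      Unique xs → All (Orbit g x) xs → x ∈ xs →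
      ∃[ ys ] Unique ys × All (Orbit g x) ys × x ∈ ys × Closed ys
    saturate x fuel xs bound xs! orb x∈
      with any? (λ j → any? (λ i → ¬? (to (g i) (lookupᴸ xs j) ∈? xs)))
    ... | no ∄ = xs , xs! , orb , x∈ , λ i {y} y∈ →
      decidable-stable (_ ∈? _) λ y∉ → ∄ (index y∈ , i ,
        subst (λ z → to (g i) z ∉ xs) (lookup-index y∈) y∉)
    ... | yes (j , i , y∉) = extend fuel bound
      where
      y = to (g i) (lookupᴸ xs j)
      y∷xs! : Unique (y ∷ xs)
      y∷xs! = ¬Any⇒All¬ xs y∉ ∷ xs!
      extend : ∀ fuel → N ≤ fuel ℕ.+ length xs →
        ∃[ ys ] Unique ys × All (Orbit g x) ys × x ∈ ys × Closed ys
      -- Without fuel `xs` already has at least `N` entries, so the longer list `y ∷ xs` cannot be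
      -- free of repetitions.
      extend zero       bound = contradiction (ℕₚ.≤-trans (length≤ e y∷xs!) bound) ℕₚ.1+n≰n
      extend (suc fuel) bound = saturate x fuel (y ∷ xs)
        (subst (N ≤_) (sym (ℕₚ.+-suc fuel (length xs))) bound)
        y∷xs! (orbit-step i (All.lookup orb (∈-lookup j)) ∷ orb) (there x∈)

    orbit-list : (∀ i x → from (g i) x ≡ to (g i) x) → ∀ x →
      ∃[ xs ] Unique xs × (∀ y → y ∈ xs ⇔ Orbit g x y) × Closed xs
    orbit-list self-inverse x
      with xs , xs! , orb , x∈ , closed ← saturate x N (x ∷ []) (ℕₚ.m≤m+n N 1)
             ([] ∷ []) (orbit-refl ∷ []) (here refl)
      = xs , xs! , (λ y → mk⇔ (All.lookup orb)
          (orbit-preserves self-inverse (_∈ xs) closed x∈)) , closed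

-- Sums over lists closed under an involution

module _ (M : CommutativeMonoid 0ℓ 0ℓ) where

  open CommutativeMonoid M using (Carrier; _≈_; reflexive) renaming (trans to ≈-trans)
  open import Algebra.Properties.CommutativeMonoid.Sum M using (sum; sum-permute; sum-cong-≗)

  -- On a closed repetition-free list, `f` induces a map `π` of positions. It is an involution,
  -- hence a permutation, and reindexing by it leaves the sum unchanged.
  sum-involution : ∀ {A : Set} (f : A → A) → (∀ x → f (f x) ≡ x) →
    ∀ {xs} → Unique xs → (∀ {y} → y ∈ xs → f y ∈ xs) →
    (F : A → Carrier) → sum (F ∘ lookupᴸ xs) ≈ sum (F ∘ f ∘ lookupᴸ xs)
  sum-involution f f-inv {xs} xs! closed F = ≈-trans
    (sum-permute (F ∘ lookupᴸ xs) (Perm.permutation π π π-inv π-inv))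
    (reflexive (sum-cong-≗ (λ j → cong F (lookup-π j))))
    where
    π : Fin (length xs) → Fin (length xs)
    π j = index (closed (∈-lookup {xs = xs} j))
    lookup-π : ∀ j → lookupᴸ xs (π j) ≡ f (lookupᴸ xs j)
    lookup-π j = sym (lookup-index (closed (∈-lookup j)))
    π-inv : ∀ j → π (π j) ≡ j
    π-inv j = lookup-injective xs!
      (trans (lookup-π (π j)) (trans (cong f (lookup-π j)) (f-inv _)))

-- Arithmetic in the prime field

module PrimeField (p : ℕ) .{{_ : NonZero p}} where

  open CommutativeRing (𝔽-commutativeRing p) hiding (refl; sym; trans)
  open RingProperties ring using (-‿distribʳ-*; +-inverseʳ-unique)
  open Mult semiring using (×-assoc-*) renaming (_×_ to _·_)
  open ≡-Reasoning

  toℕ-mod : ∀ n → toℕ (n mod p) ≡ n % p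
  toℕ-mod n = toℕ-fromℕ< (m%n<n n p)

  mod-homo-+ : ∀ m n → (m ℕ.+ n) mod p ≡ m mod p + n mod p
  mod-homo-+ m n = toℕ-injective (trans (toℕ-mod (m ℕ.+ n)) (trans (%-distribˡ-+ m n p)
    (sym (trans (toℕ-mod _) (cong₂ (λ i j → (i ℕ.+ j) % p) (toℕ-mod m) (toℕ-mod n))))))

  mod-homo-* : ∀ m n → (m ℕ.* n) mod p ≡ m mod p * (n mod p)
  mod-homo-* m n = toℕ-injective (trans (toℕ-mod (m ℕ.* n)) (trans (%-distribˡ-* m n p)
    (sym (trans (toℕ-mod _) (cong₂ (λ i j → (i ℕ.* j) % p) (toℕ-mod m) (toℕ-mod n))))))

  toℕ-0# : toℕ 0# ≡ 0
  toℕ-0# = trans (toℕ-mod 0) (m<n⇒m%n≡m (ℕ.>-nonZero⁻¹ p))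

  mod≡0⇒∣ : ∀ n → n mod p ≡ 0# → p ∣ n
  mod≡0⇒∣ n eq = m%n≡0⇒n∣m n p (trans (sym (toℕ-mod n)) (trans (cong toℕ eq) toℕ-0#))

  p-mod : p mod p ≡ 0#
  p-mod = toℕ-injective (trans (toℕ-mod p) (trans (n%n≡0 p) (sym toℕ-0#)))

  toℕ-mod-p : ∀ x → toℕ x mod p ≡ x
  toℕ-mod-p x = toℕ-injective (trans (toℕ-mod (toℕ x)) (m<n⇒m%n≡m (toℕ<n x)))

  ·1#≡mod : ∀ n → n · 1# ≡ n mod p
  ·1#≡mod zero    = refl
  ·1#≡mod (suc n) = trans (cong (1# +_) (·1#≡mod n)) (sym (mod-homo-+ 1 n))

  -- Turns a sum of `n` equal terms into a product in the field, from which `n mod p` can be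
  -- isolated.
  ·≡mod* : ∀ n x → n · x ≡ n mod p * x
  ·≡mod* n x = begin
    n · x          ≡⟨ cong (n ·_) (*-identityˡ x) ⟨
    n · (1# * x)   ≡⟨ ×-assoc-* n 1# x ⟨
    (n · 1#) * x   ≡⟨ cong (_* x) (·1#≡mod n) ⟩
    n mod p * x    ∎

  2* : ∀ x → 2 mod p * x ≡ x + x
  2* x = trans (sym (·≡mod* 2 x)) (cong (x +_) (+-identityʳ x))

  4-mod : 4 mod p ≡ (1# + 1#) + (1# + 1#)
  4-mod = trans (mod-homo-+ 2 2) (cong₂ _+_ (mod-homo-+ 1 1) (mod-homo-+ 1 1))

  module _ (p-prime : Prime p) where

    -- A nonzero residue is coprime to `p`, and a Bézout identity reduced modulo `p` exhibits its
    -- inverse.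
    inverse-exists : ∀ x → x ≢ 0# → ∃[ y ] x * y ≡ 1#
    inverse-exists x x≢0 = go (coprime-Bézout (prime⇒coprime p-prime (toℕ<n x)))
      where
      instance
        toℕx≢0 : NonZero (toℕ x)
        toℕx≢0 = ℕ.≢-nonZero λ eq → x≢0 (toℕ-injective (trans eq (sym toℕ-0#)))
      *-p-mod : ∀ u → (u ℕ.* p) mod p ≡ 0#
      *-p-mod u = trans (mod-homo-* u p) (trans (cong (u mod p *_) p-mod) (zeroʳ (u mod p)))
      *-toℕ-mod : ∀ v → (v ℕ.* toℕ x) mod p ≡ x * (v mod p)
      *-toℕ-mod v = trans (mod-homo-* v (toℕ x))
        (trans (cong (v mod p *_) (toℕ-mod-p x)) (*-comm (v mod p) x))
      go : Bézout.Identity 1 p (toℕ x) → ∃[ y ] x * y ≡ 1#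
      -- Here `1 + v x = u p`, so `v` inverts `x` up to sign.
      go (Bézout.+- u v eq) = - (v mod p) , (begin
        x * - (v mod p)  ≡⟨ -‿distribʳ-* x (v mod p) ⟨
        - (x * (v mod p))  ≡⟨ +-inverseʳ-unique (x * (v mod p)) 1# (begin
          x * (v mod p) + 1#                ≡⟨ +-comm (x * (v mod p)) 1# ⟩
          1# + x * (v mod p)                ≡⟨ cong (1# +_) (*-toℕ-mod v) ⟨
          1# + (v ℕ.* toℕ x) mod p        ≡⟨ mod-homo-+ 1 _ ⟨
          (1 ℕ.+ v ℕ.* toℕ x) mod p       ≡⟨ cong (_mod p) eq ⟩
          (u ℕ.* p) mod p                 ≡⟨ *-p-mod u ⟩
          0#                              ∎) ⟨
        1#               ∎)
      go (Bézout.-+ u v eq) = v mod p , (begin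
        x * (v mod p)               ≡⟨ *-toℕ-mod v ⟨
        (v ℕ.* toℕ x) mod p       ≡⟨ cong (_mod p) eq ⟨
        (1 ℕ.+ u ℕ.* p) mod p     ≡⟨ mod-homo-+ 1 _ ⟩
        1# + (u ℕ.* p) mod p      ≡⟨ cong (1# +_) (*-p-mod u) ⟩
        1# + 0#                   ≡⟨ +-identityʳ 1# ⟩
        1#                        ∎)

    recip : 𝔽 p → 𝔽 p
    recip x with x ≟ 0#
    -- The value at 0 is a convention that makes `recip` total.
    ... | yes _  = 0#
    ... | no x≢0 = proj₁ (inverse-exists x x≢0)

    recip-inverse : ∀ {x} → x ≢ 0# → x * recip x ≡ 1#
    recip-inverse {x} x≢0 with x ≟ 0#
    ... | yes x≡0 = contradiction x≡0 x≢0
    ... | no x≢0  = proj₂ (inverse-exists x x≢0)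

    *-cancelʳ-0 : ∀ {x y} → y ≢ 0# → x * y ≡ 0# → x ≡ 0#
    *-cancelʳ-0 {x} {y} y≢0 xy≡0 = begin
      x                  ≡⟨ *-identityʳ x ⟨
      x * 1#             ≡⟨ cong (x *_) (recip-inverse y≢0) ⟨
      x * (y * recip y)  ≡⟨ *-assoc x y (recip y) ⟨
      x * y * recip y    ≡⟨ cong (_* recip y) xy≡0 ⟩
      0# * recip y       ≡⟨ zeroˡ _ ⟩
      0#                 ∎

    *-cancelˡ-nonzero : ∀ {x y z} → x ≢ 0# → x * y ≡ x * z → y ≡ z
    *-cancelˡ-nonzero {x} {y} {z} x≢0 xy≡xz = begin
      y                  ≡⟨ undo y ⟨
      recip x * (x * y)  ≡⟨ cong (recip x *_) xy≡xz ⟩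
      recip x * (x * z)  ≡⟨ undo z ⟩
      z                  ∎
      where
      undo : ∀ y → recip x * (x * y) ≡ y
      undo y = begin
        recip x * (x * y)  ≡⟨ *-assoc (recip x) x y ⟨
        recip x * x * y    ≡⟨ cong (_* y) (trans (*-comm (recip x) x) (recip-inverse x≢0)) ⟩
        1# * y             ≡⟨ *-identityˡ y ⟩
        y                  ∎

    x²≡0⇒x≡0 : ∀ {x} → x * x ≡ 0# → x ≡ 0#
    x²≡0⇒x≡0 {x} x²≡0 with x ≟ 0#
    ... | yes x≡0 = x≡0
    ... | no x≢0  = *-cancelʳ-0 x≢0 x²≡0

-- Weights at solutions

module Scalars (p : ℕ) .{{_ : NonZero p}} (p-prime : Prime p) (s : 𝔽 p) where

  open CommutativeRing (𝔽-commutativeRing p) hiding (refl; sym; trans)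
  open SemiringSolver commutativeSemiring hiding (_:-_; :-_)
  open PrimeField p
  open WeightIdentities (𝔽-commutativeRing p)
  open Correction

  inv : 𝔽 p → 𝔽 p
  inv = recip p-prime

  Solution : (a b c x y z : 𝔽 p) → Set
  Solution a b c x y z =
    x * x + y * y + z * z + a * y * z + b * x * z + c * x * y ≡ s * x * y * z

  Nontrivial : (x y z : 𝔽 p) → Set
  Nontrivial x y z = ¬ (x ≡ 0# × y ≡ 0# × z ≡ 0#)

  Solution-rotate : ∀ a b c x y z → Solution a b c x y z → Solution b c a y z x
  Solution-rotate a b c x y z eq = trans
    (solve 6 (λ a b c x y z →
        y :* y :+ z :* z :+ x :* x :+ b :* z :* x :+ c :* y :* x :+ a :* y :* z
        := x :* x :+ y :* y :+ z :* z :+ a :* y :* z :+ b :* x :* z :+ c :* x :* y)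
      refl a b c x y z)
    (trans eq (solve 4 (λ s x y z → s :* x :* y :* z := s :* y :* z :* x) refl s x y z))

  solution-x≡0 : ∀ a b c y z → Solution a b c 0# y z → y * y + z * z + a * y * z ≡ 0#
  solution-x≡0 a b c y z eq = trans
    (solve 5 (λ a b c y z → y :* y :+ z :* z :+ a :* y :* z
      := con 0 :* con 0 :+ y :* y :+ z :* z :+ a :* y :* z :+ b :* con 0 :* z :+ c :* con 0 :* y)
      refl a b c y z)
    (trans eq (solve 3 (λ s y z → s :* con 0 :* y :* z := con 0) refl s y z))

  solution-y≡0 : ∀ a b c x z → Solution a b c x 0# z → x * x + z * z + b * x * z ≡ 0#
  solution-y≡0 a b c x z eq = trans
    (solve 3 (λ b x z → x :* x :+ z :* z :+ b :* x :* z := z :* z :+ x :* x :+ b :* z :* x) refl b x z)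
    (solution-x≡0 b c a z x (Solution-rotate a b c x 0# z eq))

  solution-z≡0 : ∀ a b c x y → Solution a b c x y 0# → x * x + y * y + c * x * y ≡ 0#
  solution-z≡0 a b c x y eq = solution-x≡0 c a b x y
    (Solution-rotate b c a y 0# x (Solution-rotate a b c x y 0# eq))

  -- With `z = 0` the form reduces to `y * y`, which forces `y = 0`. Applied where one coordinate
  -- vanishes, this shows that a nonzero solution has no second vanishing coordinate.
  isotropic-nonzeroʳ : ∀ d {y z} → y * y + z * z + d * y * z ≡ 0# → ¬ (y ≡ 0# × z ≡ 0#) → z ≢ 0#
  isotropic-nonzeroʳ d {y} eq nt refl = nt (x²≡0⇒x≡0 p-prime (trans
    (solve 2 (λ d y → y :* y := y :* y :+ con 0 :* con 0 :+ d :* y :* con 0) refl d y) eq) , refl)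

  isotropic-nonzeroˡ : ∀ d {y z} → y * y + z * z + d * y * z ≡ 0# → ¬ (y ≡ 0# × z ≡ 0#) → y ≢ 0#
  isotropic-nonzeroˡ d {y} {z} eq nt = isotropic-nonzeroʳ d
    (trans (solve 3 (λ d y z → z :* z :+ y :* y :+ d :* z :* y := y :* y :+ z :* z :+ d :* y :* z)
      refl d y z) eq)
    λ (z≡0 , y≡0) → nt (y≡0 , z≡0)

  -- The weight attached to the coordinate u, where y is the next coordinate and
  -- z the previous one; J and K belong to the points with y = 0 and with z = 0.
  weight : ∀ {b b₁ b₂ c c₁ c₂} → Correction b b₁ b₂ → Correction c c₁ c₂ →
    (u : 𝔽 p) {y z : 𝔽 p} → Dec (y ≡ 0#) → Dec (z ≡ 0#) → 𝔽 p
  weight J K u {y} {z} (yes _) _       = s + C J * inv z + D J * inv u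
  weight J K u {y} {z} (no _)  (yes _) = s + B K * inv y + A K * inv u
  weight {b} {c = c} J K u {y} {z} (no _) (no _) = generic-weight b c u (inv y) (inv z)

  -- The move fixes `y` and `z`, so both points fall under the same clause of `weight`. Counted
  -- cyclically from the vanishing coordinate, `u` comes second if `y = 0` and first if `z = 0`;
  -- hence the coefficients `C`, `D` of `J` in one case and `B`, `A` of `K` in the other.
  weight-pairing : ∀ a {b b₁ b₂ c c₁ c₂} (J : Correction b b₁ b₂) (K : Correction c c₁ c₂)
    u u′ {y z} (y? : Dec (y ≡ 0#)) (z? : Dec (z ≡ 0#)) →
    Solution a b c u y z → Solution a b c u′ y z → Nontrivial u y z → Nontrivial u′ y z →
    u + u′ + b * z + c * y ≡ s * z * y →
    weight J K u y? z? + weight J K u′ y? z? ≡ s + s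
  weight-pairing a {b} {c = c} J K u u′ {z = z} (yes refl) z? eq eq′ nt nt′ sum =
    degenerate-pairing s b (C J) (D J) (inv u) (inv u′) (inv z) (C+C≈aD J)
      (inverse-sum b u (inv u) u′ (inv u′) z (inv z)
        (recip-inverse p-prime (isotropic-nonzeroˡ b q (λ (i , j) → nt (i , refl , j))))
        (recip-inverse p-prime (isotropic-nonzeroˡ b q′ (λ (i , j) → nt′ (i , refl , j))))
        (recip-inverse p-prime (isotropic-nonzeroʳ b q (λ (i , j) → nt (i , refl , j))))
        (trans (solve 5 (λ b c u u′ z → u :+ u′ :+ b :* z := u :+ u′ :+ b :* z :+ c :* con 0)
          refl b c u u′ z) (trans sum (zeroʳ (s * z))))
        q q′)
    where
    q  = solution-y≡0 a b c u z eq
    q′ = solution-y≡0 a b c u′ z eq′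
  weight-pairing a {b} {c = c} J K u u′ {y} (no y≢0) (yes refl) eq eq′ nt nt′ sum =
    degenerate-pairing s c (B K) (A K) (inv u) (inv u′) (inv y) (B+B≈aA K)
      (inverse-sum c u (inv u) u′ (inv u′) y (inv y)
        (recip-inverse p-prime (isotropic-nonzeroˡ c q (λ (i , j) → nt (i , j , refl))))
        (recip-inverse p-prime (isotropic-nonzeroˡ c q′ (λ (i , j) → nt′ (i , j , refl))))
        (recip-inverse p-prime y≢0)
        (trans (solve 5 (λ b c u u′ y → u :+ u′ :+ c :* y := u :+ u′ :+ b :* con 0 :+ c :* y)
          refl b c u u′ y) (trans sum (solve 2 (λ s y → s :* con 0 :* y := con 0) refl s y)))
        q q′)
    where
    q  = solution-z≡0 a b c u y eq
    q′ = solution-z≡0 a b c u′ y eq′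
  weight-pairing a {b} {c = c} J K u u′ {y} {z} (no y≢0) (no z≢0) _ _ _ _ sum =
    generic-pairing s b c u u′ y (inv y) z (inv z)
      (recip-inverse p-prime y≢0) (recip-inverse p-prime z≢0) sum

  cyclic : ∀ x y z → x + y + z ≡ y + z + x
  cyclic = solve 3 (λ x y z → x :+ y :+ z := y :+ z :+ x) refl

  weight-total : ∀ {a b c} (I : Correction a b c) (J : Correction b c a) (K : Correction c a b)
    {x y z} (x? : Dec (x ≡ 0#)) (y? : Dec (y ≡ 0#)) (z? : Dec (z ≡ 0#)) →
    Solution a b c x y z → Nontrivial x y z →
    weight J K x y? z? + weight K I y z? x? + weight I J z x? y? ≡ s + s
  weight-total {a} {b} {c} I J K {x} {y} {z} (no x≢0) (no y≢0) (no z≢0) eq _ =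
    generic-total s a b c x (inv x) y (inv y) z (inv z)
      (recip-inverse p-prime x≢0) (recip-inverse p-prime y≢0) (recip-inverse p-prime z≢0) eq
  weight-total I J K {y = y} {z} (yes refl) (no _) (no _) _ _ =
    degenerate-total s I (inv y) (inv z)
  -- The sum is rotated so that the weight of the vanishing coordinate comes first, as in
  -- `degenerate-total`.
  weight-total {a} {c = c} I J K {x} {z = z} (no _) (yes refl) (no _) _ _ = trans
    (cyclic (s + C J * inv z + D J * inv x) (generic-weight c a 0# (inv z) (inv x)) (s + B J * inv x + A J * inv z))
    (degenerate-total s J (inv z) (inv x))
  weight-total {a} {b} I J K {x} {y} (no _) (no _) (yes refl) _ _ = trans
    (sym (cyclic (generic-weight a b 0# (inv x) (inv y)) (s + B K * inv y + A K * inv x) (s + C K * inv x + D K * inv y)))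
    (degenerate-total s K (inv x) (inv y))
  -- Two vanishing coordinates would force the third to vanish, against `nt`.
  weight-total {a} {b} {c} I J K (yes refl) (yes refl) _ eq nt =
    contradiction refl (isotropic-nonzeroˡ a (solution-x≡0 a b c _ _ eq) λ (i , j) → nt (refl , i , j))
  weight-total {a} {b} {c} I J K (yes refl) (no _) (yes refl) eq nt =
    contradiction refl (isotropic-nonzeroʳ a (solution-x≡0 a b c _ _ eq) λ (i , j) → nt (refl , i , j))
  weight-total {a} {b} {c} I J K (no x≢0) (yes refl) (yes refl) eq nt =
    contradiction refl (isotropic-nonzeroʳ b (solution-y≡0 a b c _ _ eq) λ (i , j) → nt (i , refl , j))

-- Summation over an orbit

module Divisibility (p : ℕ) .{{_ : NonZero p}} (p-prime : Prime p) (a : Vec (𝔽 p) 3) where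

  open CommutativeRing (𝔽-commutativeRing p) hiding (refl; sym; trans)
  open Sum +-commutativeMonoid using (sum; ∑-distrib-+; sum-replicate; sum-cong-≗)
  open Surface p a
  open PrimeField p
  open WeightIdentities (𝔽-commutativeRing p)
  open Scalars p p-prime s

  -- Supplies the bound p³ on repetition-free lists of points that makes the enumeration of orbits
  -- finite.
  S↣Fin : S ↣ Fin (p ℕ.* (p ℕ.* p))
  S↣Fin = mk↣ {to = code} λ {x} {y} → code-injective x y
    where
    code : S → Fin (p ℕ.* (p ℕ.* p))
    code (x ∷ y ∷ z ∷ [] , _) = combine x (combine y z)
    code-injective : ∀ v w → code v ≡ code w → v ≡ w
    code-injective (x ∷ y ∷ z ∷ [] , _) (x′ ∷ y′ ∷ z′ ∷ [] , _) eq
      with refl , eq′ ← combine-injective x (combine y z) x′ (combine y′ z′) eq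
      with refl , refl ← combine-injective y z y′ z′ eq′ = S-≡ refl

  move-origin : ∀ i → move i origin ≡ origin
  move-origin i = S-≡ (fixed i)
    where
    fixed : ∀ i → moveVec i (proj₁ origin) ≡ proj₁ origin
    fixed 0F = cong (λ w → w ∷ 0# ∷ 0# ∷ []) (zero-image s (lookup a 1F) (lookup a 2F))
    fixed 1F = cong (λ w → 0# ∷ w ∷ 0# ∷ []) (zero-image s (lookup a 2F) (lookup a 0F))
    fixed 2F = cong (λ w → 0# ∷ 0# ∷ w ∷ []) (zero-image s (lookup a 0F) (lookup a 1F))

  move-≢origin : ∀ i {x} → x ≢ origin → move i x ≢ origin
  move-≢origin i {x} x≢0 eq =
    x≢0 (trans (sym (move-involutive i x)) (trans (cong (move i) eq) (move-origin i)))

  -- Used in contrapositive form: a point whose orbit is not that of the origin differs from the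
  -- origin.
  origin-orbit : Orbit m origin ≐ ｛ origin ｝
  origin-orbit =
    orbit-preserves m (λ _ _ → refl) ｛ origin ｝
      (λ { i refl → sym (move-origin i) }) refl ,
    λ { refl → orbit-refl m }

  nontrivial : ∀ {x y z e} → (x ∷ y ∷ z ∷ [] , e) ≢ origin → Nontrivial x y z
  nontrivial v≢0 (refl , refl , refl) = v≢0 (S-≡ refl)

  module _ (corr : ∀ i → Correction (lookup a i) (lookup a (next i)) (lookup a (prev i))) where

    W : Fin 3 → S → 𝔽 p
    W i (v , _) = weight (corr (next i)) (corr (prev i)) (lookup v i)
      (lookup v (next i) ≟ 0#) (lookup v (prev i) ≟ 0#)

    W-total : ∀ {v} → v ≢ origin → W 0F v + W 1F v + W 2F v ≡ s + s
    W-total {x ∷ y ∷ z ∷ [] , eq} v≢0 = weight-total (corr 0F) (corr 1F) (corr 2F)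
      (x ≟ 0#) (y ≟ 0#) (z ≟ 0#) eq (nontrivial v≢0)

    W-pairing : ∀ i {v} → v ≢ origin → W i v + W i (move i v) ≡ s + s
    W-pairing 0F {v@(x ∷ y ∷ z ∷ [] , eq)} v≢0 =
      weight-pairing (lookup a 0F) (corr 1F) (corr 2F) x (moved 0F (proj₁ v)) (y ≟ 0#) (z ≟ 0#)
        eq (proj₂ (move 0F v)) (nontrivial v≢0) (nontrivial (move-≢origin 0F v≢0))
        (vieta x (s * z * y) (lookup a 1F * z) (lookup a 2F * y))
    W-pairing 1F {v@(x ∷ y ∷ z ∷ [] , eq)} v≢0 =
      weight-pairing (lookup a 1F) (corr 2F) (corr 0F) y y′ (z ≟ 0#) (x ≟ 0#)
        -- Rotating the equation puts the moved coordinate first, as `weight-pairing` expects.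
        (Solution-rotate a₁ a₂ a₃ x y z eq)
        (Solution-rotate a₁ a₂ a₃ x y′ z (proj₂ (move 1F v)))
        (λ (j , k , i) → nontrivial v≢0 (i , j , k))
        (λ (j , k , i) → nontrivial (move-≢origin 1F v≢0) (i , j , k))
        (vieta y (s * x * z) (a₃ * x) (a₁ * z))
      where
      a₁ = lookup a 0F
      a₂ = lookup a 1F
      a₃ = lookup a 2F
      y′ = moved 1F (proj₁ v)
    W-pairing 2F {v@(x ∷ y ∷ z ∷ [] , eq)} v≢0 =
      weight-pairing (lookup a 2F) (corr 0F) (corr 1F) z z′ (x ≟ 0#) (y ≟ 0#)
        (Solution-rotate a₂ a₃ a₁ y z x (Solution-rotate a₁ a₂ a₃ x y z eq))
        (Solution-rotate a₂ a₃ a₁ y z′ x (Solution-rotate a₁ a₂ a₃ x y z′ (proj₂ (move 2F v))))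
        (λ (k , i , j) → nontrivial v≢0 (i , j , k))
        (λ (k , i , j) → nontrivial (move-≢origin 2F v≢0) (i , j , k))
        (vieta z (s * y * x) (a₁ * y) (a₂ * x))
      where
      a₁ = lookup a 0F
      a₂ = lookup a 1F
      a₃ = lookup a 2F
      z′ = moved 2F (proj₁ v)

    module _ {xs : List S} (xs! : Unique xs) (closed : Closed m xs)
             (xs≢0 : ∀ j → lookupᴸ xs j ≢ origin) where

      private
        n = length xs
        pt = lookupᴸ xs

      ∑W+∑W : ∀ i → sum (W i ∘ pt) + sum (W i ∘ pt) ≡ sum {n} (λ _ → s + s)
      ∑W+∑W i = begin
        sum (W i ∘ pt) + sum (W i ∘ pt)
          ≡⟨ cong (sum (W i ∘ pt) +_) (sum-involution +-commutativeMonoid (move i) (move-involutive i) xs! (closed i) (W i)) ⟩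
        sum (W i ∘ pt) + sum (W i ∘ move i ∘ pt)
          ≡⟨ ∑-distrib-+ (W i ∘ pt) (W i ∘ move i ∘ pt) ⟨
        sum (λ j → W i (pt j) + W i (move i (pt j)))
          ≡⟨ sum-cong-≗ (λ j → W-pairing i (xs≢0 j)) ⟩
        sum {n} (λ _ → s + s) ∎
        where open ≡-Reasoning

      ∑W-total : sum (W 0F ∘ pt) + sum (W 1F ∘ pt) + sum (W 2F ∘ pt) ≡ sum {n} (λ _ → s + s)
      ∑W-total = begin
        sum (W 0F ∘ pt) + sum (W 1F ∘ pt) + sum (W 2F ∘ pt)
          ≡⟨ cong (_+ sum (W 2F ∘ pt)) (∑-distrib-+ (W 0F ∘ pt) (W 1F ∘ pt)) ⟨
        sum (λ j → W 0F (pt j) + W 1F (pt j)) + sum (W 2F ∘ pt)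
          ≡⟨ ∑-distrib-+ (λ j → W 0F (pt j) + W 1F (pt j)) (W 2F ∘ pt) ⟨
        sum (λ j → W 0F (pt j) + W 1F (pt j) + W 2F (pt j))
          ≡⟨ sum-cong-≗ (λ j → W-total (xs≢0 j)) ⟩
        sum {n} (λ _ → s + s) ∎
        where open ≡-Reasoning

      p∣length : s + s ≢ 0# → p ∣ n
      p∣length 2s≢0 = mod≡0⇒∣ n (*-cancelʳ-0 p-prime 2s≢0
        (trans (sym (·≡mod* n (s + s))) (trans (sym (sum-replicate n))
          (double-counting (sum (W 0F ∘ pt)) (sum (W 1F ∘ pt)) (sum (W 2F ∘ pt)) (sum {n} (λ _ → s + s))
            (∑W+∑W 0F) (∑W+∑W 1F) (∑W+∑W 2F) ∑W-total))))

    orbit-divisible : s + s ≢ 0# → ∀ x → ¬ (Orbit m x ≐ ｛ origin ｝) →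
      ∃[ n ] (HasSize (Orbit m x) n × p ∣ n)
    orbit-divisible 2s≢0 x nontriv =
      let xs , xs! , enum , closed = orbit-list m S↣Fin (λ _ _ → refl) x
          -- Moves preserve being different from the origin, so the weight identities hold at every
          -- point of the orbit.
          xs≢0 j = orbit-preserves m (λ _ _ → refl) (_≢ origin) (λ i → move-≢origin i)
            (λ { refl → nontriv origin-orbit }) (Equivalence.to (enum _) (∈-lookup j))
      in length xs , (xs , xs! , refl , enum) , p∣length xs! closed xs≢0 2s≢0

-- Solvability of the three linear systems

module Proportionality (p : ℕ) .{{_ : NonZero p}} (p-prime : Prime p) (2≢0 : 2 mod p ≢ 0 mod p) where

  open CommutativeRing (𝔽-commutativeRing p) hiding (refl; sym; trans)
  open SemiringSolver commutativeSemiring hiding (_:-_; :-_)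
  open PrimeField p
  open WeightIdentities (𝔽-commutativeRing p)
  open ≡-Reasoning

  private
    two = 2 mod p

  x+x≢0 : ∀ {x} → x ≢ 0# → x + x ≢ 0#
  x+x≢0 {x} x≢0 eq = 2≢0 (*-cancelʳ-0 p-prime x≢0 (trans (2* x) eq))

  -- Stated as an implication so that one condition covers both halves of the theorem: it is vacuous
  -- when `a * a` is not 4, and otherwise it is the compatibility condition of the singular system.
  Special : (a b c : 𝔽 p) → Set
  Special a b c = a * a ≡ 4 mod p → two * c ≡ b * a

  -- Multiply `2c = ba` by `b`, replace `b * b` by 4 and cancel one factor 2.
  special-next : ∀ a b c → two * c ≡ b * a → Special b c a
  special-next a b c 2c≡ba b²≡4 = *-cancelˡ-nonzero p-prime 2≢0 (begin
    two * (two * a)   ≡⟨ *-assoc two two a ⟨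
    two * two * a     ≡⟨ cong (_* a) (mod-homo-* 2 2) ⟨
    4 mod p * a       ≡⟨ cong (_* a) b²≡4 ⟨
    b * b * a         ≡⟨ solve 2 (λ a b → b :* b :* a := b :* a :* b) refl a b ⟩
    b * a * b         ≡⟨ cong (_* b) 2c≡ba ⟨
    two * c * b       ≡⟨ *-assoc two c b ⟩
    two * (c * b)     ∎)

  -- Multiply `2c = ba` by `a`, replace `a * a` by 4 and cancel one factor 2.
  special-prev : ∀ a b c → a * a ≡ 4 mod p → two * c ≡ b * a → Special c a b
  special-prev a b c a²≡4 2c≡ba _ = *-cancelˡ-nonzero p-prime 2≢0 (begin
    two * (two * b)   ≡⟨ *-assoc two two b ⟨
    two * two * b     ≡⟨ cong (_* b) (mod-homo-* 2 2) ⟨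
    4 mod p * b       ≡⟨ cong (_* b) a²≡4 ⟨
    a * a * b         ≡⟨ solve 2 (λ a b → a :* a :* b := b :* a :* a) refl a b ⟩
    b * a * a         ≡⟨ cong (_* a) 2c≡ba ⟨
    two * c * a       ≡⟨ solve 3 (λ a c t → t :* c :* a := t :* (a :* c)) refl a c two ⟩
    two * (a * c)     ∎)

  SpecialAt : Vec (𝔽 p) 3 → Fin 3 → Set
  SpecialAt a i = Special (lookup a i) (lookup a (next i)) (lookup a (prev i))

  -- The proportionality at one index propagates to the next and the previous one, so a single index
  -- with the stated property suffices for all three systems.
  special-everywhere : ∀ a i → lookup a i * lookup a i ≡ 4 mod p →
    two * lookup a (prev i) ≡ lookup a (next i) * lookup a i → ∀ j → SpecialAt a j
  special-everywhere (a₁ ∷ a₂ ∷ a₃ ∷ []) 0F sq eq = λ where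
    0F _ → eq
    1F   → special-next a₁ a₂ a₃ eq
    2F   → special-prev a₁ a₂ a₃ sq eq
  special-everywhere (a₁ ∷ a₂ ∷ a₃ ∷ []) 1F sq eq = λ where
    0F   → special-prev a₂ a₃ a₁ sq eq
    1F _ → eq
    2F   → special-next a₂ a₃ a₁ eq
  special-everywhere (a₁ ∷ a₂ ∷ a₃ ∷ []) 2F sq eq = λ where
    0F   → special-next a₃ a₁ a₂ eq
    1F   → special-prev a₃ a₁ a₂ sq eq
    2F _ → eq

  -- The determinant `four - a * a` decides between Cramer's rule and the singular case.
  correction : ∀ a b c → Special a b c → Correction a b c
  correction a b c special = go (a * a ≟ 4 mod p)
    where
    open GroupProperties +-group using (//-rightDividesˡ)
    go : Dec (a * a ≡ 4 mod p) → Correction a b c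
    go (yes a²≡4) = correction-special a b c
      (trans (sym (2* c)) (trans (special a²≡4) (*-comm b a)))
    go (no a²≢4) = correction-generic a b c (recip p-prime (four - a * a))
      (recip-inverse p-prime λ eq → a²≢4 (begin
        a * a                       ≡⟨ +-identityˡ (a * a) ⟨
        0# + a * a                  ≡⟨ cong (_+ a * a) eq ⟨
        four - a * a + a * a        ≡⟨ //-rightDividesˡ (a * a) four ⟩
        four                        ≡⟨ 4-mod ⟨
        4 mod p                     ∎))

theorem1p1 : (p : ℕ) .{{_ : NonZero p}} → Prime p → 5 ≤ p →
  (a : Vec (𝔽 p) 3) →
  let open CommutativeRing (𝔽-commutativeRing p) using (_*_)
      open Surface p a
      PDividesNontrivialOrbits =
        ∀ (x : S) → ¬ (Orbit m x ≐ ｛ origin ｝) →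
          ∃[ n ] (HasSize (Orbit m x) n × p ∣ n)
  in
  s ≢ 0 mod p →
  ((∀ i → lookup a i * lookup a i ≢ 4 mod p) → PDividesNontrivialOrbits)
  ×
  ((∃[ i ] (lookup a i * lookup a i ≡ 4 mod p
            × (2 mod p) * lookup a (prev i) ≡ lookup a (next i) * lookup a i)) →
    PDividesNontrivialOrbits)
theorem1p1 p p-prime 5≤p a s≢0 =
  -- In the first half no `a * a` is 4, so every `SpecialAt` holds vacuously.
  (λ a²≢4 → divisible λ j a²≡4 → contradiction a²≡4 (a²≢4 j)) ,
  (λ (i , a²≡4 , eq) → divisible (special-everywhere a i a²≡4 eq))
  where
  open PrimeField p using (toℕ-mod; toℕ-0#)
  open Divisibility p p-prime a using (orbit-divisible)
  2≢0 : 2 mod p ≢ 0 mod p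
  -- Since `2 < p`, the residue of 2 is 2 itself.
  2≢0 eq = contradiction
    (trans (sym (m<n⇒m%n≡m (ℕₚ.<-≤-trans (ℕ.s<s (ℕ.s<s ℕ.z<s)) 5≤p)))
      (trans (sym (toℕ-mod 2)) (trans (cong toℕ eq) toℕ-0#)))
    λ ()
  open Proportionality p p-prime 2≢0
  divisible : (∀ j → SpecialAt a j) → _
  divisible special = orbit-divisible (λ j → correction _ _ _ (special j)) (x+x≢0 s≢0)
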